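{- Let $(P,\leqslant)$ be a locally finite poset having a minimum element $\hat{0}$, and suppose $P$ has the Möbius uncertainty property, i.e. whenever $f,g:P\to\mathbb{C}$ are functions, neither identically zero, with $g(z)=\sum_{x\leqslant z} f(x)$ for all $z\in P$, at least one of $\operatorname{supp}(f)=\{x:f(x)\neq0\}$ and $\operatorname{supp}(g)=\{x:g(x)\neq0\}$ is infinite. Then for every subset $S\subset P$ with $1\leqslant |S|\leqslant 2$, there exists $z\in S$ such that there are infinitely many $x\in P$ with $x\geqslant z$ but $x\not\geqslant y$ for every $y\in S\setminus\{z\}$.
   Context: A poset is locally finite if every interval $\{z: x\leqslant z\leqslant y\}$ is finite. -}

module Defs where

open import Data.List using (List; length; map; foldr)
import Data.List.Membership.Setoid as Membership
import Data.List.Relation.Unary.Unique.Setoid as UniqueSetoid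
open import Data.Nat as ℕ using (ℕ)
import Data.Nat.Properties as ℕ
open import Data.Product using (∃; _×_; _,_; proj₂)
open import Data.Product.Relation.Binary.Pointwise.NonDependent using (×-setoid)
open import Data.Rational using (ℚ; 0ℚ; ½; _+_; _-_; _*_; _<_; ∣_∣)
import Data.Rational.Properties as ℚ
open import Data.Rational.Solver using (module +-*-Solver)
open import Data.Sum using (_⊎_)
open import Function.Bundles using (Func; _⇔_; mk⇔; module Equivalence)
open import Level using (Level; 0ℓ; _⊔_)
open import Relation.Binary.Bundles using (Poset; Setoid)
open import Relation.Binary.Definitions using (Minimum)
open import Relation.Binary.PropositionalEquality
  using (_≡_; refl; sym; trans; cong; subst)
open import Relation.Nullary using (¬_)
open import Relation.Unary using (Pred)

open +-*-Solver using (solve; _:=_; _:+_; _:-_; :-_)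

private
  variable
    a c ℓ ℓ₁ ℓ₂ p : Level

half-pos : ∀ {ε} → 0ℚ < ε → 0ℚ < ½ * ε
half-pos {ε} ε>0 = subst (_< ½ * ε) (ℚ.*-zeroʳ ½) (ℚ.*-monoʳ-<-pos ½ ε>0)

half+half : ∀ ε → ½ * ε + ½ * ε ≡ ε
half+half ε = trans (sym (ℚ.*-distribʳ-+ ε ½ ½)) (ℚ.*-identityˡ ε)

sum-within : ∀ {p q} ε → ∣ p ∣ < ½ * ε → ∣ q ∣ < ½ * ε → ∣ p + q ∣ < ε
sum-within {p} {q} ε p< q< = subst (∣ p + q ∣ <_) (half+half ε)
  (ℚ.≤-<-trans (ℚ.∣p+q∣≤∣p∣+∣q∣ p q) (ℚ.+-mono-< p< q<))

∣-∣-sym : ∀ p q → ∣ p - q ∣ ≡ ∣ q - p ∣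
∣-∣-sym p q = trans (sym (ℚ.∣-p∣≡∣p∣ (p - q))) (cong ∣_∣
  (solve 2 (λ p q → :- (p :- q) := q :- p) refl p q))

telescope : ∀ p q r → (p - q) + (q - r) ≡ p - r
telescope = solve 3 (λ p q r → (p :- q) :+ (q :- r) := p :- r) refl

interchange : ∀ p q r s → (p - r) + (q - s) ≡ (p + q) - (r + s)
interchange = solve 4
  (λ p q r s → (p :- r) :+ (q :- s) := (p :+ q) :- (r :+ s)) refl

-- Real numbers: Cauchy sequences of rationals, two sequences being
-- identified by _≈ℝ_ when their difference tends to 0.

IsCauchy : (ℕ → ℚ) → Set
IsCauchy s = ∀ ε → 0ℚ < ε →
  ∃ λ N → ∀ m n → N ℕ.≤ m → N ℕ.≤ n → ∣ s m - s n ∣ < ε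

record ℝ : Set where
  constructor mkℝ
  field
    seq    : ℕ → ℚ
    cauchy : IsCauchy seq

open ℝ public

infix 4 _≈ℝ_

_≈ℝ_ : ℝ → ℝ → Set
x ≈ℝ y = ∀ ε → 0ℚ < ε → ∃ λ N → ∀ n → N ℕ.≤ n → ∣ seq x n - seq y n ∣ < ε

≈ℝ-refl : ∀ {x} → x ≈ℝ x
≈ℝ-refl {x} ε ε>0 = 0 , λ n _ →
  subst (λ t → ∣ t ∣ < ε) (sym (ℚ.+-inverseʳ (seq x n))) ε>0

≈ℝ-sym : ∀ {x y} → x ≈ℝ y → y ≈ℝ x
≈ℝ-sym {x} {y} x≈y ε ε>0 with x≈y ε ε>0
... | N , close = N , λ n N≤n →
  subst (_< ε) (∣-∣-sym (seq x n) (seq y n)) (close n N≤n)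

≈ℝ-trans : ∀ {x y z} → x ≈ℝ y → y ≈ℝ z → x ≈ℝ z
≈ℝ-trans {x} {y} {z} x≈y y≈z ε ε>0
  with x≈y (½ * ε) (half-pos ε>0) | y≈z (½ * ε) (half-pos ε>0)
... | M , close₁ | N , close₂ = M ℕ.⊔ N , λ n M⊔N≤n →
  subst (λ t → ∣ t ∣ < ε) (telescope (seq x n) (seq y n) (seq z n))
    (sum-within ε (close₁ n (ℕ.m⊔n≤o⇒m≤o M N M⊔N≤n))
                  (close₂ n (ℕ.m⊔n≤o⇒n≤o M N M⊔N≤n)))

ℝ-setoid : Setoid 0ℓ 0ℓ
ℝ-setoid = record
  { Carrier       = ℝ
  ; _≈_           = _≈ℝ_
  ; isEquivalence = record
    { refl  = λ {x} → ≈ℝ-refl {x}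
    ; sym   = λ {x} {y} → ≈ℝ-sym {x} {y}
    ; trans = λ {x} {y} {z} → ≈ℝ-trans {x} {y} {z}
    }
  }

fromℚ : ℚ → ℝ
fromℚ q = mkℝ (λ _ → q) λ ε ε>0 → 0 , λ _ _ _ _ →
  subst (λ t → ∣ t ∣ < ε) (sym (ℚ.+-inverseʳ q)) ε>0

infixl 6 _+ℝ_

_+ℝ_ : ℝ → ℝ → ℝ
x +ℝ y = mkℝ (λ n → seq x n + seq y n) cauchy-+
  where
  cauchy-+ : IsCauchy (λ n → seq x n + seq y n)
  cauchy-+ ε ε>0
    with cauchy x (½ * ε) (half-pos ε>0) | cauchy y (½ * ε) (half-pos ε>0)
  ... | M , close₁ | N , close₂ = M ℕ.⊔ N , λ m n M⊔N≤m M⊔N≤n →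
    subst (λ t → ∣ t ∣ < ε)
      (interchange (seq x m) (seq y m) (seq x n) (seq y n))
      (sum-within ε
        (close₁ m n (ℕ.m⊔n≤o⇒m≤o M N M⊔N≤m) (ℕ.m⊔n≤o⇒m≤o M N M⊔N≤n))
        (close₂ m n (ℕ.m⊔n≤o⇒n≤o M N M⊔N≤m) (ℕ.m⊔n≤o⇒n≤o M N M⊔N≤n)))

-- Complex numbers, as pairs (real part , imaginary part).  Summation
-- and supports involve only equality, 0 and addition, so the
-- multiplication of ℂ is not defined.

ℂ-setoid : Setoid 0ℓ 0ℓ
ℂ-setoid = ×-setoid ℝ-setoid ℝ-setoid

open Setoid ℂ-setoid public
  using () renaming (Carrier to ℂ; _≈_ to _≈ℂ_; _≉_ to _≉ℂ_)

0ℂ : ℂ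
0ℂ = fromℚ 0ℚ , fromℚ 0ℚ

infixl 6 _+ℂ_

_+ℂ_ : ℂ → ℂ → ℂ
(x , y) +ℂ (u , v) = x +ℝ u , y +ℝ v

module _ (A : Setoid a ℓ) where
  open Setoid A using (Carrier)
  open Membership A using (_∈_)
  open UniqueSetoid A using (Unique)

  -- The equivalence makes P closed under the setoid equality, and the
  -- list has no repetitions, so its length is the cardinality of P.
  record Finite (P : Pred Carrier p) : Set (a ⊔ ℓ ⊔ p) where
    field
      elements  : List Carrier
      unique    : Unique elements
      enumerate : ∀ x → x ∈ elements ⇔ P x

  Infinite : Pred Carrier p → Set (a ⊔ ℓ ⊔ p)
  Infinite P = ¬ Finite P

module _ {A : Setoid a ℓ} {P : Pred (Setoid.Carrier A) p} where

  card : Finite A P → ℕ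
  card fin = length (Finite.elements fin)

  sumOver : Finite A P → (Setoid.Carrier A → ℂ) → ℂ
  sumOver fin f = foldr _+ℂ_ 0ℂ (map f (Finite.elements fin))

module _ (P : Poset c ℓ₁ ℓ₂) where
  open Poset P using (Carrier; _≤_; module Eq)

  LocallyFinite : Set (c ⊔ ℓ₁ ⊔ ℓ₂)
  LocallyFinite = ∀ x y → Finite Eq.setoid (λ z → x ≤ z × z ≤ y)

  finite-≤ : LocallyFinite → ∀ {0̂} → Minimum _≤_ 0̂ →
             ∀ z → Finite Eq.setoid (_≤ z)
  finite-≤ locFin {0̂} min z = record
    { elements  = Finite.elements fin
    ; unique    = Finite.unique fin
    ; enumerate = λ x → mk⇔
        (λ x∈ → proj₂ (Equivalence.to (Finite.enumerate fin x) x∈))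
        (λ x≤z → Equivalence.from (Finite.enumerate fin x) (min x , x≤z))
    }
    where
    fin : Finite Eq.setoid (λ x → 0̂ ≤ x × x ≤ z)
    fin = locFin 0̂ z

  -- A function P → ℂ is a map of setoids, i.e. it respects the
  -- equalities of P and ℂ.
  Fun : Set (c ⊔ ℓ₁)
  Fun = Func Eq.setoid ℂ-setoid

  IdenticallyZero : Fun → Set c
  IdenticallyZero f = ∀ x → Func.to f x ≈ℂ 0ℂ

  supp : Fun → Pred Carrier 0ℓ
  supp f x = Func.to f x ≉ℂ 0ℂ

  MöbiusUncertainty : LocallyFinite → ∀ {0̂} → Minimum _≤_ 0̂ →
                      Set (c ⊔ ℓ₁)
  MöbiusUncertainty locFin min = (f g : Fun) →
    ¬ IdenticallyZero f → ¬ IdenticallyZero g →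
    (∀ z → Func.to g z ≈ℂ sumOver (finite-≤ locFin min z) (Func.to f)) →
    Infinite Eq.setoid (supp f) ⊎ Infinite Eq.setoid (supp g)

-- Let S = {a} or S = {a , b}, and take f = δ a or f = δ a − δ b, where δ is
-- the Kronecker delta.  Its sum g over lower sets is 1[a ≤ z], respectively
-- 1[a ≤ z] − 1[b ≤ z], so supp g consists of the elements above exactly one
-- member of S; it is nonempty by antisymmetry.  If the conclusion failed,
-- supp g would be finite, against Möbius uncertainty.
{-# OPTIONS --safe #-}
module Submission where

open import Defs
open import Algebra.Properties.Group using (x∙y⁻¹≈ε⇒x≈y)
open import Axiom.ExcludedMiddle using (ExcludedMiddle)
open import Data.List using (List; []; _∷_; _++_; map; foldr; filter; deduplicate)
import Data.List.Membership.Setoid as Membership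
import Data.List.Membership.Setoid.Properties as Membershipₚ
open import Data.List.Relation.Unary.All using ([]; _∷_)
open import Data.List.Relation.Unary.AllPairs using ([]; _∷_)
open import Data.List.Relation.Unary.Any using (here; there)
import Data.List.Relation.Unary.Unique.DecSetoid.Properties as UniqueDecₚ
import Data.List.Relation.Unary.Unique.Setoid as UniqueSetoid
import Data.List.Relation.Unary.Unique.Setoid.Properties as Uniqueₚ
import Data.Nat as ℕ
import Data.Nat.Properties as ℕ
open import Data.Product using (∃; _×_; _,_; proj₁; proj₂)
open import Data.Rational using (ℚ; 0ℚ; 1ℚ; _+_; _-_; ∣_∣)
import Data.Rational as ℚ using (_<_)
import Data.Rational.Properties as ℚ
open import Data.Sum using (inj₁; inj₂)
open import Function.Base using (_∘_)
open import Function.Bundles using (mk⇔; module Equivalence)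
open import Level using (Level; _⊔_; Lift; lift; lower)
open import Relation.Binary.Bundles using (DecSetoid; Poset; Setoid)
open import Relation.Binary.Core using (_Preserves_⟶_)
open import Relation.Binary.Definitions using (Decidable; Minimum; _Respects_)
open import Relation.Binary.PropositionalEquality
  using (_≡_; _≢_; refl; sym; trans; cong; cong₂; subst)
open import Relation.Nullary using (¬_; Dec; yes; no; contradiction)
import Relation.Nullary.Decidable as Dec
import Relation.Unary as Unary
open import Relation.Unary using (Pred)

private
  variable
    a b ℓ p : Level

-- Deciding the `Lift` of a type decides the type, so one hypothesis at the joint level also decides
-- `_≈_` and `_≤_`.
em-lower : ∀ b → ExcludedMiddle (a ⊔ b) → ExcludedMiddle a
em-lower b em {A} = Dec.map′ lower lift (em {Lift b A})

-- Rationals inside the complex numbers.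

≡⇒≈ℝ : ∀ {x y} → (∀ n → seq x n ≡ seq y n) → x ≈ℝ y
≡⇒≈ℝ {x} {y} x≡y ε ε>0 = 0 , λ n _ → subst (λ t → ∣ t ∣ ℚ.< ε)
  (sym (trans (cong (_- seq y n) (x≡y n)) (ℚ.+-inverseʳ (seq y n)))) ε>0

-- Were `∣ p - q ∣` positive, it could be taken as ε, and the constant difference would be smaller
-- than itself.
fromℚ-injective : ∀ {p q} → fromℚ p ≈ℝ fromℚ q → p ≡ q
fromℚ-injective {p} {q} p≈q = x∙y⁻¹≈ε⇒x≈y ℚ.+-0-group p q
  (ℚ.∣p∣≡0⇒p≡0 (p - q) (ℚ.≤-antisym (ℚ.≮⇒≥ 0≮∣p-q∣) (ℚ.0≤∣p∣ (p - q))))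
  where
  0≮∣p-q∣ : ¬ (0ℚ ℚ.< ∣ p - q ∣)
  0≮∣p-q∣ 0<d with p≈q _ 0<d
  ... | N , close = ℚ.<-irrefl refl (close N ℕ.≤-refl)

-- The functions used below take only the values -1, 0 and 1, so they are built over ℚ, where
-- equality is decidable, and then embedded.
fromℚℂ : ℚ → ℂ
fromℚℂ q = fromℚ q , fromℚ 0ℚ

fromℚℂ-cong : ∀ {p q} → p ≡ q → fromℚℂ p ≈ℂ fromℚℂ q
fromℚℂ-cong {p} refl = Setoid.refl ℂ-setoid {x = fromℚℂ p}

sumℚ : {A : Set a} → (A → ℚ) → List A → ℚ
sumℚ h xs = foldr _+_ 0ℚ (map h xs)

-- Each term of the real part's sequence is the rational sum, and each term of the imaginary part's
-- is 0. The comparison is made term by term, since `_≈ℝ_` looks only at the sequences.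
fromℚℂ-sum : {A : Set a} (h : A → ℚ) (xs : List A) → ∀ {q} → q ≡ sumℚ h xs →
             fromℚℂ q ≈ℂ foldr _+ℂ_ 0ℂ (map (fromℚℂ ∘ h) xs)
fromℚℂ-sum h xs {q} refl =
  ≡⇒≈ℝ {fromℚ q} {proj₁ (sumℂ xs)} (λ n → sym (re n xs)) ,
  ≡⇒≈ℝ {fromℚ 0ℚ} {proj₂ (sumℂ xs)} (λ n → sym (im n xs))
  where
  sumℂ = λ xs → foldr _+ℂ_ 0ℂ (map (fromℚℂ ∘ h) xs)

  re : ∀ n xs → seq (proj₁ (sumℂ xs)) n ≡ sumℚ h xs
  re n []       = refl
  re n (x ∷ xs) = cong (h x +_) (re n xs)

  im : ∀ n xs → seq (proj₂ (sumℂ xs)) n ≡ 0ℚ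
  im n []       = refl
  im n (x ∷ xs) = cong (0ℚ +_) (im n xs)

sumℚ-minus : {A : Set a} (h k : A → ℚ) (xs : List A) →
             sumℚ (λ x → h x - k x) xs ≡ sumℚ h xs - sumℚ k xs
sumℚ-minus h k []       = refl
sumℚ-minus h k (x ∷ xs) = trans (cong (h x - k x +_) (sumℚ-minus h k xs))
  (interchange (h x) (sumℚ h xs) (k x) (sumℚ k xs))

-- The Iverson bracket.
𝟙 : {A : Set a} → Dec A → ℚ
𝟙 (yes _) = 1ℚ
𝟙 (no _)  = 0ℚ

𝟙-cong : {A : Set a} {B : Set b} (A? : Dec A) (B? : Dec B) →
         (A → B) → (B → A) → 𝟙 A? ≡ 𝟙 B?
𝟙-cong (yes _) (yes _) _   _   = refl
𝟙-cong (yes x) (no ¬y) A→B _   = contradiction (A→B x) ¬y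
𝟙-cong (no ¬x) (yes y) _   B→A = contradiction (B→A y) ¬x
𝟙-cong (no _)  (no _)  _   _   = refl

𝟙-yes : {A : Set a} (A? : Dec A) → A → 𝟙 A? ≡ 1ℚ
𝟙-yes A? x = 𝟙-cong A? (yes x) (λ y → y) (λ y → y)

𝟙-no : {A : Set a} (A? : Dec A) → ¬ A → 𝟙 A? ≡ 0ℚ
𝟙-no A? ¬x = 𝟙-cong A? (no ¬x) (λ y → y) (λ y → y)

-- Finite sets and Kronecker deltas over a decidable setoid.

module _ (D : DecSetoid a ℓ) where
  open DecSetoid D renaming (refl to ≈-refl; sym to ≈-sym; trans to ≈-trans)
  open Membership setoid using (_∈_; _∉_)
  open UniqueSetoid setoid using (Unique)

  -- Deduplication makes the covering list repetition-free, and filtering then discards the entries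
  -- outside `P`.
  finite-from-cover : {P : Pred Carrier p} → Unary.Decidable P →
                      P Respects _≈_ → (xs : List Carrier) →
                      (∀ {x} → P x → x ∈ xs) → Finite setoid P
  finite-from-cover P? resp xs cover = record
    { elements  = filter P? (deduplicate _≟_ xs)
    ; unique    = Uniqueₚ.filter⁺ setoid P? (UniqueDecₚ.deduplicate-! D xs)
    ; enumerate = λ x → mk⇔
        (proj₂ ∘ Membershipₚ.∈-filter⁻ setoid P? resp {xs = deduplicate _≟_ xs})
        (λ Px → Membershipₚ.∈-filter⁺ setoid P? resp
          (Membershipₚ.∈-deduplicate⁺ setoid _≟_
            (λ z≈y x≈y → ≈-trans x≈y (≈-sym z≈y)) (cover Px)) Px)
    }

  δ : Carrier → Carrier → ℚ
  δ u x = 𝟙 (x ≟ u)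

  δ-cong : ∀ u → δ u Preserves _≈_ ⟶ _≡_
  δ-cong u {x} {y} x≈y =
    𝟙-cong (x ≟ u) (y ≟ u) (≈-trans (≈-sym x≈y)) (≈-trans x≈y)

  sumℚ-δ-∉ : ∀ u {xs} → u ∉ xs → sumℚ (δ u) xs ≡ 0ℚ
  sumℚ-δ-∉ u {[]}     _    = refl
  sumℚ-δ-∉ u {x ∷ xs} u∉xs = cong₂ _+_
    (𝟙-no (x ≟ u) (u∉xs ∘ here ∘ ≈-sym)) (sumℚ-δ-∉ u (u∉xs ∘ there))

  -- Since the list has no repetitions, exactly one entry contributes 1.
  sumℚ-δ-∈ : ∀ u {xs} → Unique xs → u ∈ xs → sumℚ (δ u) xs ≡ 1ℚ
  sumℚ-δ-∈ u {x ∷ xs} (x∉xs ∷ _) (here u≈x) = cong₂ _+_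
    (𝟙-yes (x ≟ u) (≈-sym u≈x))
    (sumℚ-δ-∉ u (Membershipₚ.∉-resp-≈ setoid (≈-sym u≈x)
      (Membershipₚ.All[≉]⇒∉ setoid x∉xs)))
  sumℚ-δ-∈ u {x ∷ xs} (x∉xs ∷ xs!) (there u∈xs) = cong₂ _+_
    (𝟙-no (x ≟ u) (λ x≈u → Membershipₚ.All[≉]⇒∉ setoid x∉xs
      (Membershipₚ.∈-resp-≈ setoid (≈-sym x≈u) u∈xs)))
    (sumℚ-δ-∈ u xs! u∈xs)

-- Möbius uncertainty for rational-valued functions.

module _ {c ℓ₁ ℓ₂} (P : Poset c ℓ₁ ℓ₂)
         (_≟_ : Decidable (Poset._≈_ P)) (_≤?_ : Decidable (Poset._≤_ P))
         (locFin : LocallyFinite P)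
         {0̂ : Poset.Carrier P} (min : Minimum (Poset._≤_ P) 0̂) where

  open Poset P renaming (refl to ≤-refl; trans to ≤-trans)
  open Membership Eq.setoid using (_∈_)

  private
    decSetoid : DecSetoid c ℓ₁
    decSetoid = record
      { isDecEquivalence = record { isEquivalence = isEquivalence ; _≟_ = _≟_ } }

    ↓ : Carrier → List Carrier
    ↓ z = Finite.elements (finite-≤ P locFin min z)

  above : Carrier → Carrier → ℚ
  above u z = 𝟙 (u ≤? z)

  above-cong : ∀ u → above u Preserves _≈_ ⟶ _≡_
  above-cong u {x} {y} x≈y = 𝟙-cong (u ≤? x) (u ≤? y)
    (λ u≤x → ≤-trans u≤x (reflexive x≈y))
    (λ u≤y → ≤-trans u≤y (reflexive (Eq.sym x≈y)))

  -- The list of elements below `z` contains `u` once if `u ≤ z`, and otherwise not at all.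
  above-sum : ∀ u z → above u z ≡ sumℚ (δ decSetoid u) (↓ z)
  above-sum u z with u ≤? z
  ... | yes u≤z = sym (sumℚ-δ-∈ decSetoid u (Finite.unique fin)
                    (Equivalence.from (Finite.enumerate fin u) u≤z))
    where fin = finite-≤ P locFin min z
  ... | no  u≰z = sym (sumℚ-δ-∉ decSetoid u
                    (u≰z ∘ Equivalence.to (Finite.enumerate fin u)))
    where fin = finite-≤ P locFin min z

  toFun : (h : Carrier → ℚ) → h Preserves _≈_ ⟶ _≡_ → Fun P
  toFun h h-cong = record { to = fromℚℂ ∘ h ; cong = fromℚℂ-cong ∘ h-cong }

  not-identicallyZero : ∀ {h} (h-cong : h Preserves _≈_ ⟶ _≡_) →
                        ∃ (λ x → h x ≢ 0ℚ) → ¬ IdenticallyZero P (toFun h h-cong)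
  not-identicallyZero h-cong (x , hx≢0) h≈0 = hx≢0 (fromℚ-injective (proj₁ (h≈0 x)))

  -- Membership in the support is decided by comparing rationals: an embedded rational is `≈ℂ` to
  -- `0ℂ` exactly when it is 0.
  finite-supp : ∀ {h} (h-cong : h Preserves _≈_ ⟶ _≡_) (xs : List Carrier) →
                (∀ {x} → h x ≢ 0ℚ → x ∈ xs) → Finite Eq.setoid (supp P (toFun h h-cong))
  finite-supp {h} h-cong xs cover = finite-from-cover decSetoid
    (λ x → Dec.map′ (λ hx≢0 hx≈0 → hx≢0 (fromℚ-injective (proj₁ hx≈0))) supp⇒≢0
      (Dec.¬? (h x ℚ.≟ 0ℚ)))
    (λ {x} {y} x≈y hx≉0 hy≈0 → hx≉0 (subst (λ q → fromℚℂ q ≈ℂ 0ℂ) (h-cong (Eq.sym x≈y)) hy≈0))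
    xs (cover ∘ supp⇒≢0)
    where
    supp⇒≢0 : ∀ {x} → fromℚℂ (h x) ≉ℂ 0ℂ → h x ≢ 0ℚ
    supp⇒≢0 hx≉0 hx≡0 = hx≉0 (fromℚℂ-cong hx≡0)

  -- Lists covering both supports would make both finite, refuting either alternative of the
  -- uncertainty property.
  uncertaintyℚ : MöbiusUncertainty P locFin min → (h k : Carrier → ℚ) →
                 h Preserves _≈_ ⟶ _≡_ → k Preserves _≈_ ⟶ _≡_ →
                 (∀ z → k z ≡ sumℚ h (↓ z)) →
                 ∃ (λ x → h x ≢ 0ℚ) → ∃ (λ x → k x ≢ 0ℚ) →
                 (xs ys : List Carrier) → (∀ {x} → h x ≢ 0ℚ → x ∈ xs) →
                 ¬ (∀ {x} → k x ≢ 0ℚ → x ∈ ys)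
  uncertaintyℚ mu h k h-cong k-cong k-sum h≢0 k≢0 xs ys h-cover k-cover
    with mu (toFun h h-cong) (toFun k k-cong)
           (not-identicallyZero h-cong h≢0) (not-identicallyZero k-cong k≢0)
           (λ z → fromℚℂ-sum h (↓ z) (k-sum z))
  ... | inj₁ inf = inf (finite-supp h-cong xs h-cover)
  ... | inj₂ inf = inf (finite-supp k-cong ys k-cover)

  up-set-infinite : MöbiusUncertainty P locFin min → ∀ u (ys : List Carrier) →
                    ¬ (∀ {x} → u ≤ x → x ∈ ys)
  up-set-infinite mu u ys cover = uncertaintyℚ mu (δ decSetoid u) (above u)
    (δ-cong decSetoid u) (above-cong u) (above-sum u)
    (u , λ δ≡0 → ℚ.1≢0 (trans (sym (𝟙-yes (u ≟ u) Eq.refl)) δ≡0))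
    (u , λ k≡0 → ℚ.1≢0 (trans (sym (𝟙-yes (u ≤? u) ≤-refl)) k≡0))
    (u ∷ []) ys
    (λ {x} δ≢0 → here (Dec.decidable-stable (x ≟ u) (δ≢0 ∘ 𝟙-no (x ≟ u))))
    (λ {x} k≢0 → cover (Dec.decidable-stable (u ≤? x) (k≢0 ∘ 𝟙-no (u ≤? x))))

  -- The support of `k` is the union of the two differences, so one list `ys` is assumed to cover
  -- both; uncertainty does not tell which of them is infinite.
  up-set-difference-infinite :
    MöbiusUncertainty P locFin min → ∀ {u v} → u ≉ v → (ys : List Carrier) →
    (∀ {x} → u ≤ x → ¬ v ≤ x → x ∈ ys) → ¬ (∀ {x} → v ≤ x → ¬ u ≤ x → x ∈ ys)
  up-set-difference-infinite mu {u} {v} u≉v ys cover-u cover-v =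
    uncertaintyℚ mu h k
      (λ x≈y → cong₂ _-_ (δ-cong decSetoid u x≈y) (δ-cong decSetoid v x≈y))
      (λ x≈y → cong₂ _-_ (above-cong u x≈y) (above-cong v x≈y))
      (λ z → trans (cong₂ _-_ (above-sum u z) (above-sum v z))
        (sym (sumℚ-minus (δ decSetoid u) (δ decSetoid v) (↓ z))))
      (u , h[u]≢0) k≢0 (u ∷ v ∷ []) ys h-cover k-cover
    where
    h k : Carrier → ℚ
    h x = δ decSetoid u x - δ decSetoid v x
    k x = above u x - above v x

    h[u]≢0 : h u ≢ 0ℚ
    h[u]≢0 with u ≟ u | u ≟ v
    ... | no u≉u | _       = contradiction Eq.refl u≉u
    ... | yes _  | yes u≈v = contradiction u≈v u≉v
    -- The value computes to 1 - 0, visibly nonzero.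
    ... | yes _  | no _    = λ ()

    k[u]≢0 : ¬ v ≤ u → k u ≢ 0ℚ
    k[u]≢0 v≰u with u ≤? u | v ≤? u
    ... | no u≰u | _       = contradiction ≤-refl u≰u
    ... | yes _  | yes v≤u = contradiction v≤u v≰u
    ... | yes _  | no _    = λ ()

    k[v]≢0 : ¬ u ≤ v → k v ≢ 0ℚ
    k[v]≢0 u≰v with u ≤? v | v ≤? v
    ... | _       | no v≰v = contradiction ≤-refl v≰v
    ... | yes u≤v | yes _  = contradiction u≤v u≰v
    ... | no _    | yes _  = λ ()

    k≢0 : ∃ (λ x → k x ≢ 0ℚ)
    -- `u` is a witness unless it also lies above `v`; then antisymmetry keeps `v` from lying above
    -- `u`, and `v` is one.
    k≢0 with v ≤? u
    ... | no v≰u  = u , k[u]≢0 v≰u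
    ... | yes v≤u = v , k[v]≢0 (λ u≤v → u≉v (antisym u≤v v≤u))

    h-cover : ∀ {x} → h x ≢ 0ℚ → x ∈ u ∷ v ∷ []
    h-cover {x} h≢0 with x ≟ u | x ≟ v
    ... | yes x≈u | _       = here x≈u
    ... | no _    | yes x≈v = there (here x≈v)
    ... | no _    | no _    = contradiction refl h≢0

    k-cover : ∀ {x} → k x ≢ 0ℚ → x ∈ ys
    k-cover {x} k≢0 with u ≤? x | v ≤? x
    -- Above both elements the two ones cancel.
    ... | yes _   | yes _   = contradiction refl k≢0
    ... | yes u≤x | no v≰x  = cover-u u≤x v≰x
    ... | no u≰x  | yes v≤x = cover-v v≤x u≰x
    ... | no _    | no _    = contradiction refl k≢0

theorem1p4 : ∀ {c ℓ₁ ℓ₂ p : Level} →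
    ExcludedMiddle (c ⊔ ℓ₁ ⊔ ℓ₂ ⊔ p) →
    (P : Poset c ℓ₁ ℓ₂) →
    let open Poset P in
    (locFin : LocallyFinite P) →
    (0̂ : Carrier) (min : Minimum _≤_ 0̂) →
    MöbiusUncertainty P locFin min →
    (S : Pred Carrier p) (finS : Finite Eq.setoid S) →
    1 ℕ.≤ card finS → card finS ℕ.≤ 2 →
    ∃ λ z → S z × Infinite Eq.setoid (λ x → x ≥ z × (∀ y → S y → y Eq.≉ z → x ≱ y))
-- The bounds on the cardinality leave only enumerations of length one or two.
theorem1p4 _ _ _ _ _ _ _ record { elements = [] } ()
theorem1p4 _ _ _ _ _ _ _ record { elements = _ ∷ _ ∷ _ ∷ _ } _ (ℕ.s≤s (ℕ.s≤s ()))
theorem1p4 {c} {ℓ₁} {ℓ₂} {p} em P locFin _ min mu S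
  record { elements = u ∷ [] ; enumerate = enumerate } _ _ =
  u , Equivalence.to (enumerate u) (here Eq.refl) , λ fin →
    up-set-infinite P (λ _ _ → em-lower (c ⊔ ℓ₂ ⊔ p) em) (λ _ _ → em-lower (c ⊔ ℓ₁ ⊔ p) em)
      locFin min mu u (Finite.elements fin)
      (λ {x} u≤x → Equivalence.from (Finite.enumerate fin x)
        -- No member of `S` differs from `u`, so the exclusion condition holds vacuously and the
        -- whole up-set is enumerated.
        (u≤x , λ y Sy y≉u → contradiction (only-u Sy) y≉u))
  where
  open Poset P
  only-u : ∀ {y} → S y → y ≈ u
  only-u {y} Sy with Equivalence.from (enumerate y) Sy
  ... | here y≈u = y≈u
theorem1p4 {c} {ℓ₁} {ℓ₂} {p} em P locFin _ min mu S
  record { elements = u ∷ v ∷ [] ; unique = (u≉v ∷ []) ∷ _ ; enumerate = enumerate } _ _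
  = conclude em
  where
  open Poset P

  Exclusive : Carrier → Pred Carrier _
  Exclusive z x = x ≥ z × (∀ y → S y → y Eq.≉ z → x ≱ y)

  Su : S u
  Su = Equivalence.to (enumerate u) (here Eq.refl)

  Sv : S v
  Sv = Equivalence.to (enumerate v) (there (here Eq.refl))

  u-exclusive : ∀ {x} → u ≤ x → ¬ v ≤ x → Exclusive u x
  u-exclusive {x} u≤x v≰x = u≤x , not-above
    where
    not-above : ∀ y → S y → y Eq.≉ u → x ≱ y
    not-above y Sy y≉u y≤x with Equivalence.from (enumerate y) Sy
    ... | here y≈u         = y≉u y≈u
    ... | there (here y≈v) = v≰x (≤-respˡ-≈ y≈v y≤x)

  v-exclusive : ∀ {x} → v ≤ x → ¬ u ≤ x → Exclusive v x
  v-exclusive {x} v≤x u≰x = v≤x , not-above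
    where
    not-above : ∀ y → S y → y Eq.≉ v → x ≱ y
    not-above y Sy y≉v y≤x with Equivalence.from (enumerate y) Sy
    ... | here y≈u         = u≰x (≤-respˡ-≈ y≈u y≤x)
    ... | there (here y≈v) = y≉v y≈v

  -- The two enumerations, concatenated, would cover both differences of up-sets.
  not-both-finite : Finite Eq.setoid (Exclusive u) → ¬ Finite Eq.setoid (Exclusive v)
  not-both-finite finᵤ finᵥ = up-set-difference-infinite P
    (λ _ _ → em-lower (c ⊔ ℓ₂ ⊔ p) em) (λ _ _ → em-lower (c ⊔ ℓ₁ ⊔ p) em)
    locFin min mu u≉v (Finite.elements finᵤ ++ Finite.elements finᵥ)
    (λ {x} u≤x v≰x → Membershipₚ.∈-++⁺ˡ Eq.setoid
      (Equivalence.from (Finite.enumerate finᵤ x) (u-exclusive u≤x v≰x)))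
    (λ {x} v≤x u≰x → Membershipₚ.∈-++⁺ʳ Eq.setoid (Finite.elements finᵤ)
      (Equivalence.from (Finite.enumerate finᵥ x) (v-exclusive v≤x u≰x)))

  conclude : Dec (Infinite Eq.setoid (Exclusive u)) →
             ∃ λ z → S z × Infinite Eq.setoid (Exclusive z)
  conclude (yes infᵤ) = u , Su , infᵤ
  -- `¬infᵤ` is the double negation of finiteness; this suffices because the infinitude of
  -- `Exclusive v` is itself a negation.
  conclude (no ¬infᵤ) = v , Sv , λ finᵥ →
    ¬infᵤ (λ finᵤ → not-both-finite finᵤ finᵥ)
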